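{- Let $k\ge1$ and $n$ be integers. Any two cycles of $G(n,k)$ are contiguous translates of each other: if $C_1,C_2$ are cycles of $G(n,k)$, then after possibly interchanging $C_1$ and $C_2$ there is an integer $d\ge0$ such that $C_2=C_1+d$ and $C_1+\alpha$ is a cycle of $G(n,k)$ for every integer $0\le\alpha\le d$. In particular, all cycles of $G(n,k)$ have the same length.
   Context: For an integer $\ell$, $\ell_k$ and $\ell_{k+1}$ denote the least nonnegative residues of $\ell$ modulo $k$ and $k+1$. $G(n,k)$ is the directed graph on vertices $0,1,\dots,k$ whose edges are exactly the $k$ edges $(i+n-2)_{k+1}\to(i+n-1)_k$, $1\le i\le k$; an edge $a\to a$ is a loop, counted as a cycle of length $1$. Every vertex other than $k$ and $(n-2)_{k+1}$ has in- and out-degree $1$, so $G(n,k)$ is a disjoint union of directed cycles together with one directed path (the tail) from $k$ to $(n-2)_{k+1}$. For a cycle $C: a_1\to\cdots\to a_\ell\to a_1$ and an integer $t$, $C+t$ denotes the closed walk $(a_1+t)_{k+1}\to\cdots\to(a_\ell+t)_{k+1}\to(a_1+t)_{k+1}$, and one says "$C+t$ is a cycle" when this is a cycle of $G(n,k)$. The length of a cycle is its number of edges. -}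

module Defs where

open import Data.Empty using (⊥)
open import Data.Fin.Base using (Fin; toℕ; fromℕ<)
open import Data.Integer.Base using (ℤ; +_; _+_; _-_; _%ℕ_)
open import Data.Integer.DivMod using (n%ℕd<d)
open import Data.List.Base using (List; []; _∷_; _++_; map)
open import Data.List.Relation.Unary.Linked using (Linked)
open import Data.List.Relation.Unary.Unique.Propositional using (Unique)
open import Data.Nat.Base as ℕ using (ℕ; suc; NonZero)
open import Data.Product.Base using (_×_; ∃-syntax)
open import Relation.Binary.PropositionalEquality.Core using (_≡_)

Vertex : ℕ → Set
Vertex k = Fin (suc k)

-- The edge relation of G(n,k).  The k sources are pairwise distinct, so there
-- are no parallel edges and a relation determines the graph.
Edge : (n : ℤ) (k : ℕ) .{{_ : NonZero k}} → Vertex k → Vertex k → Set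
Edge n k a b =
  ∃[ i ] (1 ℕ.≤ i × i ℕ.≤ k
         × toℕ a ≡ (+ i + n - + 2) %ℕ suc k
         × toℕ b ≡ (+ i + n - + 1) %ℕ k)

-- The list a₁ ∷ … ∷ aₗ ∷ [] stands for the closed walk a₁ → ⋯ → aₗ → a₁, so its
-- number of edges is the length of the list.
ClosedWalk : ℕ → Set
ClosedWalk k = List (Vertex k)

IsCycle : (n : ℤ) (k : ℕ) .{{_ : NonZero k}} → ClosedWalk k → Set
IsCycle n k []       = ⊥
IsCycle n k (a ∷ as) = Unique (a ∷ as) × Linked (Edge n k) (a ∷ as ++ a ∷ [])

shift : (k : ℕ) → ℤ → Vertex k → Vertex k
shift k t a = fromℕ< (n%ℕd<d (+ toℕ a + t) (suc k))

infixl 6 _⊕_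

_⊕_ : {k : ℕ} → ClosedWalk k → ℤ → ClosedWalk k
_⊕_ {k} C t = map (shift k t) C

infix 4 _≈_

-- Equality of cycles: a cycle has no distinguished starting vertex, so lists
-- are compared up to rotation.
_≈_ : {k : ℕ} → ClosedWalk k → ClosedWalk k → Set
C ≈ D = ∃[ us ] ∃[ vs ] (C ≡ us ++ vs × D ≡ vs ++ us)

ContiguousTranslate : (n : ℤ) (k : ℕ) .{{_ : NonZero k}} → ClosedWalk k → ClosedWalk k → Set
ContiguousTranslate n k C D =
  ∃[ d ] (D ≈ C ⊕ + d × (∀ (α : ℕ) → α ℕ.≤ d → IsCycle n k (C ⊕ + α)))

{-# OPTIONS --safe #-}
module Submission where

-- An edge a → b of G(n,k) can be translated by 1 unless a + 1 is the tail's end m = (n - 2)_{k+1}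
-- or b + 1 is the tail's start k.  Hence C + 1 is a cycle as soon as C contains neither k - 1 nor
-- m - 1, and since no cycle contains k, every cycle has a last translate, which contains k - 1 or
-- m - 1.  It remains to see that this last translate F is the same for all cycles.
--
-- Otherwise there are cycles F containing k - 1 but not m - 1, and F' containing m - 1 but not
-- k - 1.  Translating F by 1 gives a walk from k that ends in 0 instead of returning to k;
-- translating F' by 1 gives a walk from m + 1 to m.  Both lie on the tail, so the tail reads
-- k ⇝ 0 ⇝ m + 1 ⇝ m.  The middle part translated by -1 is a walk from k to m, that is, the whole
-- tail, although it is strictly shorter.

open import Defs
open import Data.Empty using (⊥)
open import Data.Fin.Base using (toℕ; fromℕ<)
open import Data.Fin.Properties using (toℕ-injective; toℕ-fromℕ<; toℕ<n; pigeonhole; _≟_)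
open import Data.Integer.Base using (ℤ; +_; _+_; _-_; _*_; -_; ∣_∣; _%ℕ_; _/ℕ_; 1ℤ)
open import Data.Integer.Divisibility.Signed using (_∣_; divides; ∣m∣n⇒∣m+n; ∣m⇒∣-m; ∣⇒∣ᵤ)
open import Data.Integer.DivMod using (n%ℕd<d; a≡a%ℕn+[a/ℕn]*n)
import Data.Integer.Properties as ℤ
open import Data.Integer.Tactic.RingSolver using (solve-∀)
open import Data.List.Base using (List; []; _∷_; _++_; [_]; map; length)
open import Data.List.Properties using (∷-injective; ++-identityʳ; ++-assoc; map-++; length-++; length-map; map-∘; map-id; map-cong)
open import Data.List.Membership.Propositional using (_∈_; _∉_)
open import Data.List.Membership.Propositional.Properties using (∈-∃++)
open import Data.List.Relation.Binary.Permutation.Propositional using (↭⇒↭ₛ)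
open import Data.List.Relation.Binary.Permutation.Propositional.Properties using (++-comm)
open import Data.List.Relation.Binary.Permutation.Setoid.Properties using (Unique-resp-↭)
open import Data.List.Relation.Unary.All as All using (All; []; _∷_)
import Data.List.Relation.Unary.All.Properties as All
open import Data.List.Relation.Unary.AllPairs using (_∷_)
open import Data.List.Relation.Unary.Linked as Linked using (Linked; [-]; _∷_)
open import Data.List.Relation.Unary.Unique.Propositional using (Unique)
import Data.List.Relation.Unary.Unique.Propositional.Properties as Unique
open import Data.Nat.Base as ℕ using (ℕ; zero; suc; _≤_; _<_; z≤n; s≤s; NonZero)
import Data.Nat.Divisibility as ℕ
import Data.Nat.Properties as ℕ
open import Data.Product.Base using (_×_; _,_; ∃-syntax; proj₁; proj₂)
open import Data.Sum.Base as Sum using (_⊎_; inj₁; inj₂)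
open import Function.Base using (_∘_)
open import Relation.Binary.PropositionalEquality using (_≡_; _≢_; refl; sym; trans; cong; subst; subst₂; setoid; module ≡-Reasoning)
open import Relation.Nullary using (¬_; contradiction; Dec; yes; no)
open import Relation.Nullary.Decidable using (_⊎-dec_)

-- Congruences between integers.

infix 4 _≡_mod_

-- The record keeps `x` and `y` inferable; they cannot be recovered from the difference `x - y`.
record _≡_mod_ (x y : ℤ) (d : ℕ) : Set where
  constructor congruent
  field divisible : + d ∣ x - y

open _≡_mod_

module _ {d : ℕ} where

  mod-reflexive : ∀ {x y} → x ≡ y → x ≡ y mod d
  mod-reflexive {x} refl = congruent (divides (+ 0) (ℤ.+-inverseʳ x))

  mod-sym : ∀ {x y} → x ≡ y mod d → y ≡ x mod d
  mod-sym {x} {y} x≡y = congruent (subst (+ d ∣_) (lemma x y) (∣m⇒∣-m (divisible x≡y)))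
    where
    lemma : ∀ x y → - (x - y) ≡ y - x
    lemma = solve-∀

  mod-trans : ∀ {x y z} → x ≡ y mod d → y ≡ z mod d → x ≡ z mod d
  mod-trans {x} {y} {z} x≡y y≡z =
    congruent (subst (+ d ∣_) (lemma x y z) (∣m∣n⇒∣m+n (divisible x≡y) (divisible y≡z)))
    where
    lemma : ∀ x y z → (x - y) + (y - z) ≡ x - z
    lemma = solve-∀

  mod-+ : ∀ {x y} z → x ≡ y mod d → x + z ≡ y + z mod d
  mod-+ {x} {y} z x≡y = congruent (subst (+ d ∣_) (lemma x y z) (divisible x≡y))
    where
    lemma : ∀ x y z → x - y ≡ (x + z) - (y + z)
    lemma = solve-∀

  mod-modulus : ∀ x → x + + d ≡ x mod d
  mod-modulus x = congruent (divides 1ℤ (lemma x (+ d)))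
    where
    lemma : ∀ x e → (x + e) - x ≡ 1ℤ * e
    lemma = solve-∀

  mod-small-≤ : ∀ {r s} → r ≤ s → s < d → + r ≡ + s mod d → r ≡ s
  mod-small-≤ {r} {s} r≤s s<d r≡s with s ℕ.∸ r in eq
  ... | zero  = ℕ.≤-antisym r≤s (ℕ.m∸n≡0⇒m≤n eq)
  ... | suc t = contradiction d≤s (ℕ.<⇒≱ s<d)
    where
    d∣1+t : d ℕ.∣ suc t
    d∣1+t = subst (d ℕ.∣_) (trans (cong ∣_∣ (ℤ.m-n≡m⊖n r s)) (trans (ℤ.∣⊖∣-≤ r≤s) eq))
      (∣⇒∣ᵤ (divisible r≡s))
    d≤s : d ≤ s
    d≤s = ℕ.≤-trans (ℕ.∣⇒≤ d∣1+t) (subst (_≤ s) eq (ℕ.m∸n≤m s r))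

  mod-small : ∀ {r s} → r < d → s < d → + r ≡ + s mod d → r ≡ s
  mod-small {r} {s} r<d s<d r≡s with ℕ.≤-total r s
  ... | inj₁ r≤s = mod-small-≤ r≤s s<d r≡s
  ... | inj₂ s≤r = sym (mod-small-≤ s≤r r<d (mod-sym r≡s))

module _ {d : ℕ} .{{_ : NonZero d}} where

  %ℕ-mod : ∀ x → + (x %ℕ d) ≡ x mod d
  %ℕ-mod x = mod-sym (congruent (divides (x /ℕ d) (begin
    x - + (x %ℕ d)                              ≡⟨ cong (_- + (x %ℕ d)) (a≡a%ℕn+[a/ℕn]*n x d) ⟩
    (+ (x %ℕ d) + (x /ℕ d) * + d) - + (x %ℕ d)  ≡⟨ lemma (+ (x %ℕ d)) ((x /ℕ d) * + d) ⟩
    (x /ℕ d) * + d                              ∎)))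
    where
    open ≡-Reasoning
    lemma : ∀ r q → (r + q) - r ≡ q
    lemma = solve-∀

  mod⇒%ℕ : ∀ {x r} → r < d → + r ≡ x mod d → r ≡ x %ℕ d
  mod⇒%ℕ {x} r<d r≡x = mod-small r<d (n%ℕd<d x d) (mod-trans r≡x (mod-sym (%ℕ-mod x)))

-- Vertices as residues modulo `k + 1`, and their translation.

module Vertices (k : ℕ) where

  opaque

    -- The distinguished vertices are reductions of integer expressions; opacity makes proofs
    -- compare them through congruences instead of unfolding remainders.
    ⟦_⟧ : ℤ → Vertex k
    ⟦ x ⟧ = fromℕ< (n%ℕd<d x (suc k))

    toℕ-⟦⟧ : ∀ x → toℕ ⟦ x ⟧ ≡ x %ℕ suc k
    toℕ-⟦⟧ x = toℕ-fromℕ< (n%ℕd<d x (suc k))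

    shift≡⟦⟧ : ∀ t a → shift k t a ≡ ⟦ + toℕ a + t ⟧
    shift≡⟦⟧ t a = refl

  mod⇒≡⟦⟧ : ∀ {a x} → + toℕ a ≡ x mod suc k → a ≡ ⟦ x ⟧
  mod⇒≡⟦⟧ {a} {x} a≡x = toℕ-injective (trans (mod⇒%ℕ (toℕ<n a) a≡x) (sym (toℕ-⟦⟧ x)))

  ⟦⟧-mod : ∀ x → + toℕ ⟦ x ⟧ ≡ x mod suc k
  ⟦⟧-mod x = subst (λ r → + r ≡ x mod suc k) (sym (toℕ-⟦⟧ x)) (%ℕ-mod x)

  ⟦⟧-cong : ∀ {x y} → x ≡ y mod suc k → ⟦ x ⟧ ≡ ⟦ y ⟧
  ⟦⟧-cong {x} x≡y = mod⇒≡⟦⟧ (mod-trans (⟦⟧-mod x) x≡y)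

  ⟦⟧-injective : ∀ {x y} → ⟦ x ⟧ ≡ ⟦ y ⟧ → x ≡ y mod suc k
  ⟦⟧-injective {x} {y} eq = mod-trans (mod-sym (⟦⟧-mod x))
    (subst (λ a → + toℕ a ≡ y mod suc k) (sym eq) (⟦⟧-mod y))

  ⟦toℕ⟧ : ∀ a → ⟦ + toℕ a ⟧ ≡ a
  ⟦toℕ⟧ a = sym (mod⇒≡⟦⟧ (mod-reflexive refl))

  shift-⟦⟧ : ∀ t x → shift k t ⟦ x ⟧ ≡ ⟦ x + t ⟧
  shift-⟦⟧ t x = trans (shift≡⟦⟧ t ⟦ x ⟧) (⟦⟧-cong (mod-+ t (⟦⟧-mod x)))

  shift-shift : ∀ s t a → shift k s (shift k t a) ≡ shift k (t + s) a
  shift-shift s t a = begin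
    shift k s (shift k t a)      ≡⟨ cong (shift k s) (shift≡⟦⟧ t a) ⟩
    shift k s ⟦ + toℕ a + t ⟧    ≡⟨ shift-⟦⟧ s (+ toℕ a + t) ⟩
    ⟦ + toℕ a + t + s ⟧          ≡⟨ cong ⟦_⟧ (ℤ.+-assoc (+ toℕ a) t s) ⟩
    ⟦ + toℕ a + (t + s) ⟧        ≡⟨ shift≡⟦⟧ (t + s) a ⟨
    shift k (t + s) a            ∎
    where open ≡-Reasoning

  shift-0 : ∀ a → shift k (+ 0) a ≡ a
  shift-0 a = trans (shift≡⟦⟧ (+ 0) a) (trans (cong ⟦_⟧ (ℤ.+-identityʳ (+ toℕ a))) (⟦toℕ⟧ a))

  shift-inverse : ∀ t a → shift k (- t) (shift k t a) ≡ a
  shift-inverse t a = trans (shift-shift (- t) t a)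
    (trans (cong (λ s → shift k s a) (ℤ.+-inverseʳ t)) (shift-0 a))

  shift-injective : ∀ t {a b} → shift k t a ≡ shift k t b → a ≡ b
  shift-injective t {a} {b} eq =
    trans (sym (shift-inverse t a)) (trans (cong (shift k (- t)) eq) (shift-inverse t b))

  S : Vertex k → Vertex k
  S = shift k (+ 1)

  S-surjective : ∀ a → ∃[ b ] S b ≡ a
  S-surjective a = shift k (- + 1) a , shift-inverse (- + 1) a

  -- start is the vertex k (see toℕ-start), the residue of -1 modulo k + 1.
  start start⁻ start⁺ : Vertex k
  start  = ⟦ - + 1 ⟧
  start⁻ = ⟦ - + 2 ⟧
  start⁺ = ⟦ + 0 ⟧

  S-start⁻ : S start⁻ ≡ start
  S-start⁻ = shift-⟦⟧ (+ 1) (- + 2)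

  S-start : S start ≡ start⁺
  S-start = shift-⟦⟧ (+ 1) (- + 1)

  k≡-1 : + k ≡ - + 1 mod suc k
  k≡-1 = subst (_≡ - + 1 mod suc k) (lemma (+ k)) (mod-modulus (- + 1))
    where
    lemma : ∀ e → - + 1 + (1ℤ + e) ≡ e
    lemma = solve-∀

  toℕ-start : toℕ start ≡ k
  toℕ-start = trans (toℕ-⟦⟧ (- + 1)) (sym (mod⇒%ℕ (ℕ.n<1+n k) k≡-1))

  ≢start⇒< : ∀ {a} → a ≢ start → toℕ a < k
  ≢start⇒< {a} a≢ = ℕ.≤∧≢⇒< (ℕ.≤-pred (toℕ<n a)) λ eq → a≢ (toℕ-injective (trans eq (sym toℕ-start)))

  <⇒≢start : ∀ {a} → toℕ a < k → a ≢ start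
  <⇒≢start a<k refl = ℕ.<-irrefl toℕ-start a<k

  toℕ-S : ∀ {a} → a ≢ start → toℕ (S a) ≡ suc (toℕ a)
  toℕ-S {a} a≢ = begin
    toℕ (S a)                  ≡⟨ cong toℕ (shift≡⟦⟧ (+ 1) a) ⟩
    toℕ ⟦ + toℕ a + + 1 ⟧      ≡⟨ toℕ-⟦⟧ (+ toℕ a + + 1) ⟩
    (+ toℕ a + + 1) %ℕ suc k   ≡⟨ mod⇒%ℕ (s≤s (≢start⇒< a≢)) (mod-reflexive (ℤ.+-comm 1ℤ (+ toℕ a))) ⟨
    suc (toℕ a)                ∎
    where open ≡-Reasoning

  -- No cycle contains `start`, so this `j` bounds how far a cycle through `a` can be translated
  -- step by step; it is the recursion measure of `translate-maximal-at`.
  S-reaches-start : ∀ a → ∃[ j ] shift k (+ j) a ≡ start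
  S-reaches-start a = k ℕ.∸ toℕ a , (begin
    shift k (+ (k ℕ.∸ toℕ a)) a      ≡⟨ shift≡⟦⟧ (+ (k ℕ.∸ toℕ a)) a ⟩
    ⟦ + (toℕ a ℕ.+ (k ℕ.∸ toℕ a)) ⟧  ≡⟨ cong (λ x → ⟦ + x ⟧) (ℕ.m+[n∸m]≡n (ℕ.≤-pred (toℕ<n a))) ⟩
    ⟦ + k ⟧                          ≡⟨ ⟦⟧-cong k≡-1 ⟩
    start                            ∎)
    where open ≡-Reasoning

-- The edges of the graph and their behaviour under translation.

module Graph (k : ℕ) .{{_ : NonZero k}} (n : ℤ) where
  open Vertices k public

  end end⁻ end⁺ : Vertex k
  end  = ⟦ n - + 2 ⟧
  end⁻ = ⟦ n - + 3 ⟧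
  end⁺ = ⟦ n - + 1 ⟧

  S-end⁻ : S end⁻ ≡ end
  S-end⁻ = trans (shift-⟦⟧ (+ 1) (n - + 3)) (cong ⟦_⟧ (lemma n))
    where
    lemma : ∀ n → n - + 3 + + 1 ≡ n - + 2
    lemma = solve-∀

  S-end : S end ≡ end⁺
  S-end = trans (shift-⟦⟧ (+ 1) (n - + 2)) (cong ⟦_⟧ (lemma n))
    where
    lemma : ∀ n → n - + 2 + + 1 ≡ n - + 1
    lemma = solve-∀

  -- Vertices are indexed by 0, ..., `k`: indices from 1 on are the sources of edges, and `source 0`
  -- is `end`. Translation by 1 raises the index and wraps around only after `source k`, which is
  -- `end⁻`.
  source : ℕ → Vertex k
  source i = ⟦ + i + n - + 2 ⟧

  S-source : ∀ i → S (source i) ≡ source (suc i)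
  S-source i = trans (shift-⟦⟧ (+ 1) (+ i + n - + 2)) (cong ⟦_⟧ (lemma (+ i) n))
    where
    lemma : ∀ i n → i + n - + 2 + + 1 ≡ 1ℤ + i + n - + 2
    lemma = solve-∀

  source-0 : source 0 ≡ end
  source-0 = cong (λ x → ⟦ x - + 2 ⟧) (ℤ.+-identityˡ n)

  opaque

    source-k : source k ≡ end⁻
    source-k = ⟦⟧-cong (subst (_≡ n - + 3 mod suc k) (lemma (+ k) n) (mod-modulus (n - + 3)))
      where
      lemma : ∀ e n → n - + 3 + (1ℤ + e) ≡ e + n - + 2
      lemma = solve-∀

    source-injective : ∀ {i j} → i ≤ k → j ≤ k → source i ≡ source j → i ≡ j
    source-injective {i} {j} i≤k j≤k eq = mod-small (s≤s i≤k) (s≤s j≤k)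
      (subst₂ (_≡_mod suc k) (lemma (+ i) n) (lemma (+ j) n) (mod-+ (+ 2 - n) (⟦⟧-injective eq)))
      where
      lemma : ∀ i n → i + n - + 2 + (+ 2 - n) ≡ i
      lemma = solve-∀

    source-surjective : ∀ a → ∃[ i ] (i ≤ k × a ≡ source i)
    source-surjective a = i , ℕ.≤-pred (n%ℕd<d x (suc k)) , mod⇒≡⟦⟧ (mod-sym
      (subst₂ (_≡_mod suc k) (sym (ℤ.+-assoc (+ i) n (- + 2)))
        (lemma (+ toℕ a) n) (mod-+ (n - + 2) (%ℕ-mod x))))
      where
      x : ℤ
      x = + toℕ a - (n - + 2)
      i : ℕ
      i = x %ℕ suc k
      lemma : ∀ a n → a - (n - + 2) + (n - + 2) ≡ a
      lemma = solve-∀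

  infix 4 _⟶_

  -- `Edge` in a form suited to translation: the remainder modulo `k` is replaced by a bound and a
  -- congruence, to which 1 can be added.
  data _⟶_ : Vertex k → Vertex k → Set where
    edge : ∀ {i b} → 1 ≤ i → i ≤ k → toℕ b < k → + toℕ b ≡ + i + n - + 1 mod k → source i ⟶ b

  Edge⇒⟶ : ∀ {a b} → Edge n k a b → a ⟶ b
  Edge⇒⟶ {a} {b} (i , 1≤i , i≤k , a≡ , b≡) =
    subst (_⟶ b) (toℕ-injective (trans (toℕ-⟦⟧ (+ i + n - + 2)) (sym a≡)))
      (edge 1≤i i≤k (subst (_< k) (sym b≡) (n%ℕd<d (+ i + n - + 1) k))
        (subst (λ r → + r ≡ + i + n - + 1 mod k) (sym b≡) (%ℕ-mod (+ i + n - + 1))))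

  ⟶⇒Edge : ∀ {a b} → a ⟶ b → Edge n k a b
  ⟶⇒Edge (edge {i} 1≤i i≤k b<k b≡) = i , 1≤i , i≤k , toℕ-⟦⟧ (+ i + n - + 2) , mod⇒%ℕ b<k b≡

  end-sink : ∀ {a b} → a ⟶ b → a ≢ end
  end-sink (edge 1≤i i≤k _ _) eq =
    contradiction (source-injective i≤k z≤n (trans eq (sym source-0))) (ℕ.>⇒≢ 1≤i)

  start-root : ∀ {a b} → a ⟶ b → b ≢ start
  start-root (edge _ _ b<k _) = <⇒≢start b<k

  private
    -- Endpoints are related by an explicit equation because matching on `edge` cannot unify two
    -- values of `source`; the primed lemmas below do the same.
    functional : ∀ {a a′ b c} → a ≡ a′ → a ⟶ b → a′ ⟶ c → b ≡ c
    functional eq (edge _ i≤k b<k b≡) (edge _ j≤k c<k c≡) with refl ← source-injective i≤k j≤k eq =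
      toℕ-injective (mod-small b<k c<k (mod-trans b≡ (mod-sym c≡)))

    total : ∀ {i} → 1 ≤ i → i ≤ k → ∃[ b ] source i ⟶ b
    total {i} 1≤i i≤k = b , edge 1≤i i≤k (subst (_< k) (sym toℕ-b) x%k<k)
      (subst (λ r → + r ≡ x mod k) (sym toℕ-b) (%ℕ-mod x))
      where
      x = + i + n - + 1
      x%k<k = n%ℕd<d x k
      b : Vertex k
      b = fromℕ< (ℕ.m<n⇒m<1+n x%k<k)
      toℕ-b : toℕ b ≡ x %ℕ k
      toℕ-b = toℕ-fromℕ< (ℕ.m<n⇒m<1+n x%k<k)

  ⟶-functional : ∀ {a b c} → a ⟶ b → a ⟶ c → b ≡ c
  ⟶-functional = functional refl

  -- The target fixes the index modulo `k`, and the indices 1, ..., `k` are pairwise incongruent;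
  -- their predecessors lie below `k`, as `mod-small` demands.
  ⟶-injective : ∀ {a b c} → a ⟶ c → b ⟶ c → a ≡ b
  ⟶-injective (edge {suc i} _ i<k _ c≡i) (edge {suc j} _ j<k _ c≡j) =
    cong (λ i → source (suc i)) (mod-small i<k j<k (subst₂ (_≡_mod k) (lemma (+ i) n) (lemma (+ j) n)
      (mod-+ (- n) (mod-trans (mod-sym c≡i) c≡j))))
    where
    lemma : ∀ i n → 1ℤ + i + n - + 1 + - n ≡ i
    lemma = solve-∀

  ⟶-total : ∀ {a} → a ≢ end → ∃[ b ] a ⟶ b
  ⟶-total {a} a≢end with source-surjective a
  ... | zero  , _   , refl = contradiction source-0 a≢end
  ... | suc i , i<k , refl = total (s≤s z≤n) i<k

  private
    source≢end⁻⇒< : ∀ {i} → i ≤ k → source i ≢ end⁻ → i < k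
    source≢end⁻⇒< i≤k ≢end⁻ = ℕ.≤∧≢⇒< i≤k λ { refl → ≢end⁻ source-k }

    toℕ-S<k : ∀ {b} → b ≢ start⁻ → toℕ (S b) < k
    toℕ-S<k b≢ = ≢start⇒< λ eq → b≢ (shift-injective (+ 1) (trans eq (sym S-start⁻)))

    toℕ-S-mod : ∀ {b x} → toℕ b < k → + toℕ b ≡ x mod k → + toℕ (S b) ≡ 1ℤ + x mod k
    toℕ-S-mod {b} {x} b<k b≡x = subst₂ (_≡_mod k)
      (trans (ℤ.+-comm (+ toℕ b) 1ℤ) (cong +_ (sym (toℕ-S (<⇒≢start b<k))))) (ℤ.+-comm x 1ℤ) (mod-+ 1ℤ b≡x)

    next : ∀ i → 1ℤ + (+ i + n - + 1) ≡ + suc i + n - + 1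
    next i = lemma (+ i) n
      where
      lemma : ∀ i n → 1ℤ + (i + n - + 1) ≡ 1ℤ + i + n - + 1
      lemma = solve-∀

  -- Index and target both grow by 1. The index stays at most `k` because `a` is not `source k`, and
  -- the target stays below `k` because `b` is not `k - 1`.
  ⟶-S : ∀ {a b} → a ⟶ b → a ≢ end⁻ → b ≢ start⁻ → S a ⟶ S b
  ⟶-S {b = b} (edge {i} _ i≤k b<k b≡) a≢ b≢ =
    subst (_⟶ S b) (sym (S-source i))
      (edge (s≤s z≤n) (source≢end⁻⇒< i≤k a≢) (toℕ-S<k b≢)
        (subst (+ toℕ (S b) ≡_mod k) (next i) (toℕ-S-mod b<k b≡)))

  private
    ⟶-S⁻′ : ∀ {a b c d} → c ⟶ d → c ≡ S a → d ≡ S b → a ≢ end → b ≢ start → a ⟶ b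
    ⟶-S⁻′ {a} {b} (edge {suc i} _ i<k _ d≡) c≡ refl a≢ b≢ =
      subst (_⟶ b) source-i≡a (edge (1≤i source-i≡a) (ℕ.<⇒≤ i<k) (≢start⇒< b≢)
        (subst₂ (_≡_mod k) (trans (cong (λ r → + r - + 1) (toℕ-S b≢)) (lemma′ (+ toℕ b)))
          (lemma (+ i) n) (mod-+ (- + 1) d≡)))
      where
      source-i≡a : source i ≡ a
      source-i≡a = shift-injective (+ 1) (trans (S-source i) c≡)
      1≤i : ∀ {i} → source i ≡ a → 1 ≤ i
      1≤i {zero}  eq = contradiction (trans (sym eq) source-0) a≢
      1≤i {suc _} _  = s≤s z≤n
      lemma : ∀ i n → 1ℤ + i + n - + 1 + - + 1 ≡ i + n - + 1
      lemma = solve-∀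
      lemma′ : ∀ i → 1ℤ + i - + 1 ≡ i
      lemma′ = solve-∀

    ⟶-S-start⁻′ : ∀ {a b} → a ⟶ b → b ≡ start⁻ → a ≢ end⁻ → S a ⟶ start⁺
    ⟶-S-start⁻′ (edge {i} _ i≤k b<k b≡) refl a≢ =
      subst (_⟶ start⁺) (sym (S-source i))
        (edge (s≤s z≤n) (source≢end⁻⇒< i≤k a≢)
          (subst (_< k) (sym toℕ-start⁺) (ℕ.>-nonZero⁻¹ k))
          (mod-trans 0≡k (subst (+ toℕ (S start⁻) ≡_mod k) (next i) (toℕ-S-mod b<k b≡))))
      where
      toℕ-start⁺ : toℕ start⁺ ≡ 0
      toℕ-start⁺ = toℕ-⟦⟧ (+ 0)
      0≡k : + toℕ start⁺ ≡ + toℕ (S start⁻) mod k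
      0≡k = subst₂ (λ r s → + r ≡ + s mod k) (sym toℕ-start⁺) (sym (trans (cong toℕ S-start⁻) toℕ-start))
        (mod-sym (mod-modulus (+ 0)))

    ⟶-end⁻′ : ∀ {a b} → a ⟶ b → a ≡ end⁻ → b ≢ start⁻ → end⁺ ⟶ S b
    ⟶-end⁻′ {b = b} (edge _ i≤k b<k b≡) a≡ b≢
      with refl ← source-injective i≤k ℕ.≤-refl (trans a≡ (sym source-k)) =
      subst (_⟶ S b) (cong ⟦_⟧ (lemma n)) (edge {1} ℕ.≤-refl (ℕ.>-nonZero⁻¹ k) (toℕ-S<k b≢)
        (mod-trans (toℕ-S-mod b<k b≡) (subst (_≡ 1ℤ + n - + 1 mod k) (lemma′ (+ k) n) (mod-modulus (1ℤ + n - + 1)))))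
      where
      lemma : ∀ n → 1ℤ + n - + 2 ≡ n - + 1
      lemma = solve-∀
      lemma′ : ∀ e n → 1ℤ + n - + 1 + e ≡ 1ℤ + (e + n - + 1)
      lemma′ = solve-∀

  -- Lowering the index by 1 leaves it positive because `a` is not `source 0`; as `b` is not
  -- `start`, passing from `b` to `S b` involves no wrap-around.
  ⟶-S⁻ : ∀ {a b} → S a ⟶ S b → a ≢ end → b ≢ start → a ⟶ b
  ⟶-S⁻ e = ⟶-S⁻′ e refl refl

  -- The translated target would be the number `k`, whose residue modulo `k` is 0, so the edge is
  -- diverted from `start` to `start⁺`.
  ⟶-S-start⁻ : ∀ {a} → a ⟶ start⁻ → a ≢ end⁻ → S a ⟶ start⁺
  ⟶-S-start⁻ e = ⟶-S-start⁻′ e refl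

  -- The index of `end⁻` is `k`, and `k + 1` is congruent to 1 modulo `k`; hence `S b` is entered
  -- from `source 1`, which is `end⁺`, instead of from `end`.
  ⟶-end⁻ : ∀ {b} → end⁻ ⟶ b → b ≢ start⁻ → end⁺ ⟶ S b
  ⟶-end⁻ e = ⟶-end⁻′ e refl

-- Cycles and walks of an arbitrary relation.

module _ {A : Set} (R : A → A → Set) where

  Cycle : List A → Set
  Cycle []       = ⊥
  Cycle (a ∷ as) = Unique (a ∷ as) × Linked R (a ∷ as ++ a ∷ [])

  Walk : ℕ → A → A → Set
  Walk zero    a b = a ≡ b
  Walk (suc n) a b = ∃[ c ] (Walk n a c × R c b)

module _ {A : Set} {R : A → A → Set} where

  Linked-++⁻ : ∀ xs {y ys} → Linked R (xs ++ y ∷ ys) → Linked R (xs ++ [ y ]) × Linked R (y ∷ ys)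
  Linked-++⁻ []            rs       = [-] , rs
  Linked-++⁻ (x ∷ [])      (r ∷ rs) = r ∷ [-] , rs
  Linked-++⁻ (x ∷ z ∷ xs)  (r ∷ rs) with ls , ms ← Linked-++⁻ (z ∷ xs) rs = r ∷ ls , ms

  Linked-++⁺ : ∀ xs {y ys} → Linked R (xs ++ [ y ]) → Linked R (y ∷ ys) → Linked R (xs ++ y ∷ ys)
  Linked-++⁺ []           _        ms = ms
  Linked-++⁺ (x ∷ [])     (r ∷ _)  ms = r ∷ ms
  Linked-++⁺ (x ∷ z ∷ xs) (r ∷ ls) ms = r ∷ Linked-++⁺ (z ∷ xs) ls ms

  Linked-last : ∀ {a} xs {e} → Linked R (a ∷ xs ++ [ e ]) → ∃[ x ] R x e
  Linked-last []       (r ∷ _)  = _ , r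
  Linked-last (x ∷ xs) (_ ∷ rs) = Linked-last xs rs

  Cycle-rotate : ∀ us {vs} → Cycle R (us ++ vs) → Cycle R (vs ++ us)
  Cycle-rotate []       {vs}     c = subst (Cycle R) (sym (++-identityʳ vs)) c
  Cycle-rotate (u ∷ us) {[]}     c = subst (Cycle R) (++-identityʳ (u ∷ us)) c
  Cycle-rotate (u ∷ us) {v ∷ vs} (unique , linked)
    with ls , ms ← Linked-++⁻ (u ∷ us) (subst (Linked R) (++-assoc (u ∷ us) (v ∷ vs) [ u ]) linked) =
    Unique-resp-↭ (setoid A) (↭⇒↭ₛ (++-comm (u ∷ us) (v ∷ vs))) unique ,
    subst (Linked R) (sym (++-assoc (v ∷ vs) (u ∷ us) [ v ])) (Linked-++⁺ (v ∷ vs) ms ls)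

  Cycle-rotate-to : ∀ {x C} → x ∈ C → Cycle R C → ∃[ us ] ∃[ vs ] (C ≡ us ++ x ∷ vs × Cycle R (x ∷ vs ++ us))
  Cycle-rotate-to x∈C c with us , vs , refl ← ∈-∃++ x∈C = us , vs , refl , Cycle-rotate us c

  -- Functionality forces the two walks to agree step by step; since `e` is missing from both
  -- interiors, they also stop together.
  Linked-unique : (∀ {a b c} → R a b → R a c → b ≡ c) → ∀ {a e} xs ys →
    All (e ≢_) xs → All (e ≢_) ys →
    Linked R (a ∷ xs ++ [ e ]) → Linked R (a ∷ ys ++ [ e ]) → xs ≡ ys
  Linked-unique f []       []       _          _          _        _        = refl
  Linked-unique f []       (y ∷ ys) _          (e≢y ∷ _)  (r ∷ _)  (s ∷ _)  = contradiction (f r s) e≢y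
  Linked-unique f (x ∷ xs) []       (e≢x ∷ _)  _          (r ∷ _)  (s ∷ _)  = contradiction (f s r) e≢x
  Linked-unique f (x ∷ xs) (y ∷ ys) (_ ∷ e≢xs) (_ ∷ e≢ys) (r ∷ rs) (s ∷ ss)
    with refl ← f r s = cong (x ∷_) (Linked-unique f xs ys e≢xs e≢ys rs ss)

  Walk-++ : ∀ {i a b} j {c} → Walk R i a b → Walk R j b c → Walk R (j ℕ.+ i) a c
  Walk-++ zero    v refl        = v
  Walk-++ (suc j) v (_ , w , r) = _ , Walk-++ j v w , r

  Walk-prefix : ∀ d {i a b} → Walk R (d ℕ.+ i) a b → ∃[ c ] Walk R i a c
  Walk-prefix zero    w           = _ , w
  Walk-prefix (suc d) (_ , w , _) = Walk-prefix d w

  -- The form `ℓ + 1` records that the walk has at least one step, which `Walk-prefix ℓ` can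
  -- extract.
  Linked⇒Walk : ∀ {a} xs {e} → Linked R (a ∷ xs ++ [ e ]) → ∃[ ℓ ] Walk R (ℓ ℕ.+ 1) a e
  Linked⇒Walk []       (r ∷ _)  = 0 , _ , refl , r
  Linked⇒Walk (x ∷ xs) (r ∷ rs) with ℓ , w ← Linked⇒Walk xs rs =
    ℓ ℕ.+ 1 , Walk-++ (ℓ ℕ.+ 1) (_ , refl , r) w

  module _ (functional : ∀ {a b c} → R a b → R a c → b ≡ c) where

    Walk-functional : ∀ i {a x y} → Walk R i a x → Walk R i a y → x ≡ y
    Walk-functional zero    refl        refl        = refl
    Walk-functional (suc i) (_ , v , r) (_ , w , s) with refl ← Walk-functional i v w = functional r s

    Walk-suffix : ∀ d {i a x y} → Walk R i a x → Walk R (d ℕ.+ i) a y → Walk R d x y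
    Walk-suffix zero    v w           = Walk-functional _ v w
    Walk-suffix (suc d) v (_ , w , r) = _ , Walk-suffix d v w , r

  module _ (injective : ∀ {a b c} → R a c → R b c → a ≡ b) where

    -- Read backwards from `x`, the two walks coincide.
    Walk-cancel : ∀ i {d a b x} → Walk R i a x → Walk R (i ℕ.+ d) b x → Walk R d b a
    Walk-cancel zero    refl        w           = w
    Walk-cancel (suc i) (_ , v , r) (_ , w , s) with refl ← injective r s = Walk-cancel i v w

    -- Read backwards from `e`, the walk from `z` must retrace the linked list; it cannot run out
    -- before reaching `a`, since `z` is neither `e` nor in `xs`.
    Walk-through : ∀ {z j a} xs {e} → Linked R (a ∷ xs ++ [ e ]) → All (_≢ z) xs → e ≢ z →
      Walk R j z e → ∃[ d ] ∃[ i ] (d ℕ.+ i ≡ j × Walk R i z a)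
    Walk-through {j = zero}  []       _        _          e≢z refl        = contradiction refl e≢z
    Walk-through {j = suc j} []       (r ∷ _)  _          e≢z (_ , w , s)
      with refl ← injective r s = 1 , j , refl , w
    Walk-through (x ∷ xs) (r ∷ rs) (x≢z ∷ xs≢z) e≢z w with Walk-through xs rs xs≢z e≢z w
    ... | d , zero  , refl , refl        = contradiction refl x≢z
    ... | d , suc i , refl , _ , v , s with refl ← injective r s = suc d , i , sym (ℕ.+-suc d i) , v

-- Closed walks up to rotation.

All-rotate : ∀ {A : Set} {P : A → Set} us {vs} → All P (us ++ vs) → All P (vs ++ us)
All-rotate us ps = All.++⁺ (All.++⁻ʳ us ps) (All.++⁻ˡ us ps)

++-split : ∀ {A : Set} (us : List A) {vs us′ vs′} → us ++ vs ≡ us′ ++ vs′ →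
  (∃[ ws ] (us′ ≡ us ++ ws × vs ≡ ws ++ vs′)) ⊎ (∃[ ws ] (us ≡ us′ ++ ws × vs′ ≡ ws ++ vs))
++-split []       {us′ = us′}      eq   = inj₁ (us′ , refl , eq)
++-split (u ∷ us) {us′ = []}       refl = inj₂ (u ∷ us , refl , refl)
++-split (u ∷ us) {us′ = u′ ∷ us′} eq with refl , eq′ ← ∷-injective eq =
  Sum.map (λ (ws , p , q) → ws , cong (u ∷_) p , q) (λ (ws , p , q) → ws , cong (u ∷_) p , q) (++-split us eq′)

module _ {k : ℕ} where

  ≈-sym : {C D : ClosedWalk k} → C ≈ D → D ≈ C
  ≈-sym (us , vs , p , q) = vs , us , q , p

  ≈-trans : {B C D : ClosedWalk k} → B ≈ C → C ≈ D → B ≈ D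
  ≈-trans (us , vs , refl , refl) (us′ , vs′ , p , refl) with ++-split vs {us} {us′} {vs′} p
  ... | inj₁ (ws , refl , refl) = ws , vs′ ++ vs , ++-assoc ws vs′ vs , sym (++-assoc vs′ vs ws)
  ... | inj₂ (ws , refl , refl) = us ++ us′ , ws , sym (++-assoc us us′ ws) , ++-assoc ws us us′

  ≈-length : {C D : ClosedWalk k} → C ≈ D → length C ≡ length D
  ≈-length (us , vs , refl , refl) =
    trans (length-++ us) (trans (ℕ.+-comm (length us) (length vs)) (sym (length-++ vs)))

  ≈-⊕ : ∀ {C D : ClosedWalk k} t → C ≈ D → C ⊕ t ≈ D ⊕ t
  ≈-⊕ t (us , vs , refl , refl) = us ⊕ t , vs ⊕ t , map-++ _ us vs , map-++ _ vs us

  open Vertices k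

  ⊕-⊕ : ∀ (C : ClosedWalk k) s t → C ⊕ s ⊕ t ≡ C ⊕ (s + t)
  ⊕-⊕ C s t = trans (sym (map-∘ C)) (map-cong (shift-shift t s) C)

  ⊕-0 : ∀ (C : ClosedWalk k) → C ⊕ + 0 ≡ C
  ⊕-0 C = trans (map-cong shift-0 C) (map-id C)

  ⊕-inverse : ∀ (C : ClosedWalk k) t → C ⊕ t ⊕ - t ≡ C
  ⊕-inverse C t = trans (sym (map-∘ C)) (trans (map-cong (shift-inverse t) C) (map-id C))

  -- Rotated to begin at the common vertex `x`, both cycles follow the only walk from `x` up to its
  -- first return.
  Cycle-≈ : {R : Vertex k → Vertex k → Set} → (∀ {a b c} → R a b → R a c → b ≡ c) →
    ∀ {x C D} → Cycle R C → Cycle R D → x ∈ C → x ∈ D → C ≈ D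
  Cycle-≈ functional {x} c d x∈C x∈D
    with us  , vs  , refl , (x≢₁ ∷ _) , l₁ ← Cycle-rotate-to x∈C c
       | us′ , vs′ , refl , (x≢₂ ∷ _) , l₂ ← Cycle-rotate-to x∈D d =
    ≈-trans (us , x ∷ vs , refl , refl)
      (x ∷ vs′ , us′ , cong (x ∷_) (Linked-unique functional (vs ++ us) (vs′ ++ us′) x≢₁ x≢₂ l₁ l₂) , refl)

-- Two segments that cannot both lie on the tail.

module Main (k : ℕ) .{{_ : NonZero k}} (n : ℤ) where
  open Graph k n
  open import Data.List.Membership.DecPropositional (_≟_ {suc k}) using (_∈?_)

  S-injective : ∀ {a b} → S a ≡ S b → a ≡ b
  S-injective = shift-injective (+ 1)

  -- The walks from start and from start⁺ stay one apart for ever: the first cannot reach end,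
  -- because the second runs ℓ + 1 steps ahead of it on the tail, and the second cannot reach end
  -- without passing end⁺ = S end, that is, without the first reaching end.  But the tail is finite.
  tail-segments : ∀ xs ys → Linked _⟶_ (start ∷ xs ++ [ start⁺ ]) → Linked _⟶_ (end⁺ ∷ ys ++ [ end ]) →
    All (_≢ start⁺) ys → end ≢ start⁺ → ⊥
  tail-segments xs ys from-start to-end ys≢ end≢ =
    -- Among the first `k + 2` positions two coincide; cancelling the shorter walk leaves a closed
    -- walk of positive length at `start`.
    let i , j , i<j , x≡y = pigeonhole (ℕ.n<1+n (suc k)) (λ i → proj₁ (twins (toℕ i)))
        d , 1+i+d≡j = ℕ.m≤n⇒∃[o]m+o≡n i<j
    in no-return d (Walk-cancel ⟶-injective (toℕ i) (lower (proj₂ (twins (toℕ i))))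
      (subst₂ (λ m x → Walk _⟶_ m start x) (sym (trans (ℕ.+-suc (toℕ i) d) 1+i+d≡j)) (sym x≡y)
        (lower (proj₂ (twins (toℕ j))))))
    where
    Twin : Vertex k → Vertex k → Set
    Twin a b = a ⟶ b × S a ⟶ S b

    lower : ∀ {j a b} → Walk Twin j a b → Walk _⟶_ j a b
    lower {zero}  w                 = w
    lower {suc j} (_ , w , r , _) = _ , lower w , r

    upper : ∀ {j b} → Walk Twin j start b → Walk _⟶_ j start⁺ (S b)
    upper {zero}  refl              = sym S-start
    upper {suc j} (_ , w , _ , s) = _ , upper w , s

    ℓ : ℕ
    ℓ = proj₁ (Linked⇒Walk xs from-start)

    start⇝start⁺ : Walk _⟶_ (ℓ ℕ.+ 1) start start⁺
    start⇝start⁺ = proj₂ (Linked⇒Walk xs from-start)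

    no-return : ∀ d → ¬ Walk _⟶_ (suc d) start start
    no-return d (_ , _ , r) = start-root r refl

    extend : ∀ {j b} → Walk _⟶_ j start⁺ b → Walk _⟶_ (ℓ ℕ.+ 1 ℕ.+ j) start b
    extend {j} {b} w = subst (λ m → Walk _⟶_ m start b) (ℕ.+-comm j (ℓ ℕ.+ 1)) (Walk-++ j start⇝start⁺ w)

    twin≢end : ∀ {j x} → Walk Twin j start x → x ≢ end
    -- The suffix leads from `x` to `S x` in `ℓ + 1` steps, so an edge leaves `x`.
    twin≢end w refl with _ , _ , refl , r ← Walk-prefix ℓ
      (Walk-suffix ⟶-functional (ℓ ℕ.+ 1) (lower w) (extend (upper w))) = end-sink r refl

    S-twin≢end : ∀ {j x} → Walk Twin j start x → S x ≢ end
    S-twin≢end w Sx≡end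
      -- On its way to `end` the second walk is at `end⁺` after `i` steps; the first walk is then at
      -- `end`, against `twin≢end`.
      with d , i , refl , v ← Walk-through ⟶-injective ys to-end ys≢ end≢
             (subst (Walk _⟶_ _ start⁺) Sx≡end (upper w))
      with y , u ← Walk-prefix d w =
      twin≢end u (S-injective (trans (Walk-functional ⟶-functional i (upper u) v) (sym S-end)))

    -- The second walk moves first: `S x` has a successor because it is not `end`, and that edge
    -- translated by -1 is the step of the first walk.
    twin-step : ∀ {j x} → Walk Twin j start x → ∃[ y ] Walk Twin (suc j) start y
    twin-step {j} {x} w
      with z , Sx⟶z ← ⟶-total (S-twin≢end w)
      with y , refl ← S-surjective z =
      y , x , w , ⟶-S⁻ Sx⟶z (twin≢end w) y≢start , Sx⟶z
      where
      y≢start : y ≢ start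
      -- Otherwise the second walk would return to `start⁺`; cancelling the walk from `start` to
      -- `start⁺` turns this into a return to `start`.
      y≢start refl = no-return j (Walk-cancel ⟶-injective (ℓ ℕ.+ 1) start⇝start⁺
        (extend (S x , upper w , subst (S x ⟶_) S-start Sx⟶z)))

    twins : ∀ j → ∃[ x ] Walk Twin j start x
    twins zero    = start , refl
    twins (suc j) = twin-step (proj₂ (twins j))

  -- Translating a cycle once, and uniqueness of the last translate.

  -- The last edge is left to the function argument: it is translated like the others in `Cycle-S`,
  -- but diverted to `start⁺` for a cycle through `start⁻`.
  Linked-S : ∀ {e e′} → (∀ {x} → x ≢ end⁻ → x ⟶ e → S x ⟶ e′) →
    ∀ {a} xs → a ≢ end⁻ → All (_≢ end⁻) xs → All (_≢ start⁻) xs →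
    Linked _⟶_ (a ∷ xs ++ [ e ]) → Linked _⟶_ (S a ∷ map S xs ++ [ e′ ])
  Linked-S f []       a≢ _         _         (r ∷ _)  = f a≢ r ∷ [-]
  Linked-S f (x ∷ xs) a≢ (p ∷ ps) (q ∷ qs) (r ∷ rs) = ⟶-S r a≢ q ∷ Linked-S f xs p ps qs rs

  ∉⇒All≢ : ∀ {x : Vertex k} {xs} → x ∉ xs → All (_≢ x) xs
  ∉⇒All≢ x∉ = All.map (_∘ sym) (All.¬Any⇒All¬ _ x∉)

  Cycle-S : ∀ {C} → Cycle _⟶_ C → start⁻ ∉ C → end⁻ ∉ C → Cycle _⟶_ (C ⊕ + 1)
  Cycle-S {a ∷ as} (unique , linked) start⁻∉ end⁻∉ with ∉⇒All≢ start⁻∉ | ∉⇒All≢ end⁻∉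
  ... | p ∷ ps | q ∷ qs = Unique.map⁺ S-injective unique , Linked-S (λ x≢ r → ⟶-S r x≢ p) as q qs ps linked

  start∉Cycle : ∀ {a as} → Cycle _⟶_ (a ∷ as) → a ≢ start
  start∉Cycle {as = as} (_ , linked) = start-root (proj₂ (Linked-last as linked))

  Maximal : ClosedWalk k → Set
  Maximal C = start⁻ ∈ C ⊎ end⁻ ∈ C

  -- Translation of `C`, rotated to begin at `start⁻`, diverts only the last edge; translation of
  -- `D`, rotated to begin at `end⁻`, diverts only the first. The results are the two segments that
  -- `tail-segments` refutes.
  start⁻-end⁻-together : ∀ {C D} → Cycle _⟶_ C → Cycle _⟶_ D →
    start⁻ ∈ C → end⁻ ∉ C → end⁻ ∈ D → start⁻ ∉ D → ⊥
  start⁻-end⁻-together c d start⁻∈C end⁻∉C end⁻∈D start⁻∉D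
    with us , vs , refl , start⁻≢ ∷ _ , l ← Cycle-rotate-to start⁻∈C c
       | us′ , vs′ , refl , end⁻≢ ∷ _ , l′ ← Cycle-rotate-to end⁻∈D d
    with p ∷ ps ← All-rotate us (∉⇒All≢ end⁻∉C) | q ∷ qs ← All-rotate us′ (∉⇒All≢ start⁻∉D) =
    tail-segments (map S (vs ++ us)) (map S (vs′ ++ us′))
      (subst (λ a → Linked _⟶_ (a ∷ map S (vs ++ us) ++ [ start⁺ ])) S-start⁻
        (Linked-S (λ x≢ r → ⟶-S-start⁻ r x≢) (vs ++ us) p ps (All.map (_∘ sym) start⁻≢) l))
      (subst (λ a → Linked _⟶_ (end⁺ ∷ map S (vs′ ++ us′) ++ [ a ])) S-end⁻
        (to-end (vs′ ++ us′) (All.map (_∘ sym) end⁻≢) qs q l′))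
      (S≢start⁺ (vs′ ++ us′) l′)
      (λ eq → start-root (proj₂ (Linked-last (vs′ ++ us′) l′)) (S-injective (trans S-end⁻ (trans eq (sym S-start)))))
    where
    to-end : ∀ ys → All (_≢ end⁻) ys → All (_≢ start⁻) ys → end⁻ ≢ start⁻ →
      Linked _⟶_ (end⁻ ∷ ys ++ [ end⁻ ]) → Linked _⟶_ (end⁺ ∷ map S ys ++ [ S end⁻ ])
    -- For a loop at `end⁻` the diverted first edge is also the last one.
    to-end []       _        _        r≢ (r ∷ _)  = ⟶-end⁻ r r≢ ∷ [-]
    to-end (y ∷ ys) (p ∷ ps) (q ∷ qs) r≢ (r ∷ rs) =
      ⟶-end⁻ r q ∷ Linked-S (λ x≢ s → ⟶-S s x≢ r≢) ys p ps qs rs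

    -- Each listed vertex has an incoming edge, so it is not `start`.
    S≢start⁺ : ∀ {a} ys {e} → Linked _⟶_ (a ∷ ys ++ [ e ]) → All (_≢ start⁺) (map S ys)
    S≢start⁺ []       _        = []
    S≢start⁺ (y ∷ ys) (r ∷ rs) = (λ eq → start-root r (S-injective (trans eq (sym S-start)))) ∷ S≢start⁺ ys rs

  -- Maximal cycles always share `start⁻` or `end⁻`: the mixed case without a common one is refuted
  -- by `start⁻-end⁻-together`.
  maximal-unique : ∀ {C D} → Cycle _⟶_ C → Cycle _⟶_ D → Maximal C → Maximal D → C ≈ D
  maximal-unique c d (inj₁ p) (inj₁ q) = Cycle-≈ ⟶-functional c d p q
  maximal-unique c d (inj₂ p) (inj₂ q) = Cycle-≈ ⟶-functional c d p q
  maximal-unique c d (inj₂ p) (inj₁ q) = ≈-sym (maximal-unique d c (inj₁ q) (inj₂ p))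
  maximal-unique {C} {D} c d (inj₁ p) (inj₂ q) with end⁻ ∈? C | start⁻ ∈? D
  ... | yes p′ | _      = Cycle-≈ ⟶-functional c d p′ q
  ... | no _   | yes q′ = Cycle-≈ ⟶-functional c d p q′
  ... | no p′  | no q′  = contradiction q′ (start⁻-end⁻-together c d p p′ q)

  -- Reaching the last translate, and the conclusion.

  Translates : ClosedWalk k → ℕ → Set
  Translates C d = ∀ α → α ≤ d → Cycle _⟶_ (C ⊕ + α)

  maximal? : ∀ C → Dec (Maximal C)
  maximal? C = start⁻ ∈? C ⊎-dec end⁻ ∈? C

  -- Each translation brings the first vertex one closer to `start`. At `j = 0` it would be `start`,
  -- which lies on no cycle.
  translate-maximal-at : ∀ j {a as} → shift k (+ j) a ≡ start → Cycle _⟶_ (a ∷ as) →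
    ∃[ d ] (Translates (a ∷ as) d × Maximal ((a ∷ as) ⊕ + d))
  translate-maximal-at zero {a} eq c = contradiction (trans (sym (shift-0 a)) eq) (start∉Cycle c)
  translate-maximal-at (suc j) {a} {as} eq c with maximal? (a ∷ as)
  ... | yes maximal = 0 , (λ { _ z≤n → subst (Cycle _⟶_) (sym (⊕-0 (a ∷ as))) c }) ,
    subst Maximal (sym (⊕-0 (a ∷ as))) maximal
  ... | no ¬maximal =
    let d , cycles , maximal = translate-maximal-at j (trans (shift-shift (+ j) (+ 1) a) eq)
                                 (Cycle-S c (¬maximal ∘ inj₁) (¬maximal ∘ inj₂))
    in suc d , step cycles , subst Maximal (⊕-⊕ (a ∷ as) (+ 1) (+ d)) maximal
    where
    step : ∀ {d} → Translates ((a ∷ as) ⊕ + 1) d → Translates (a ∷ as) (suc d)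
    step cycles zero    _         = subst (Cycle _⟶_) (sym (⊕-0 (a ∷ as))) c
    step cycles (suc α) (s≤s α≤d) = subst (Cycle _⟶_) (⊕-⊕ (a ∷ as) (+ 1) (+ α)) (cycles α α≤d)

  translate-maximal : ∀ {C} → Cycle _⟶_ C → ∃[ d ] (Translates C d × Maximal (C ⊕ + d))
  translate-maximal {a ∷ as} = translate-maximal-at (proj₁ (S-reaches-start a)) (proj₂ (S-reaches-start a))

  IsCycle⇒Cycle : ∀ {C} → IsCycle n k C → Cycle _⟶_ C
  IsCycle⇒Cycle {_ ∷ _} (unique , linked) = unique , Linked.map Edge⇒⟶ linked

  Cycle⇒IsCycle : ∀ {C} → Cycle _⟶_ C → IsCycle n k C
  Cycle⇒IsCycle {_ ∷ _} (unique , linked) = unique , Linked.map ⟶⇒Edge linked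

  -- Translating the common last translate back by `e` gives `D` on one side and `C ⊕ + (d ∸ e)` on
  -- the other.
  contiguous : ∀ {C D d e} → Translates C d → C ⊕ + d ≈ D ⊕ + e → e ≤ d → ContiguousTranslate n k C D
  contiguous {C} {D} {d} {e} cycles C≈D e≤d =
    d ℕ.∸ e ,
    ≈-sym (subst₂ _≈_ C-eq (⊕-inverse D (+ e)) (≈-⊕ (- + e) C≈D)) ,
    λ α α≤d∸e → Cycle⇒IsCycle (cycles α (ℕ.≤-trans α≤d∸e (ℕ.m∸n≤m d e)))
    where
    C-eq : C ⊕ + d ⊕ - + e ≡ C ⊕ + (d ℕ.∸ e)
    C-eq = begin
      C ⊕ + d ⊕ - + e                  ≡⟨ cong (λ m → C ⊕ + m ⊕ - + e) (ℕ.m∸n+n≡m e≤d) ⟨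
      C ⊕ + (d ℕ.∸ e ℕ.+ e) ⊕ - + e    ≡⟨ cong (_⊕ - + e) (⊕-⊕ C (+ (d ℕ.∸ e)) (+ e)) ⟨
      C ⊕ + (d ℕ.∸ e) ⊕ + e ⊕ - + e    ≡⟨ ⊕-inverse (C ⊕ + (d ℕ.∸ e)) (+ e) ⟩
      C ⊕ + (d ℕ.∸ e)                  ∎
      where open ≡-Reasoning

theorem3p9 : (k : ℕ) .{{_ : NonZero k}} (n : ℤ) (C₁ C₂ : ClosedWalk k) →
    IsCycle n k C₁ → IsCycle n k C₂ →
    (ContiguousTranslate n k C₁ C₂ ⊎ ContiguousTranslate n k C₂ C₁)
    × length C₁ ≡ length C₂
theorem3p9 k n C₁ C₂ c₁ c₂ =
  -- The cycle farther from the common last translate is the one to be translated forward onto the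
  -- other.
  Sum.map (contiguous cycles₁ F₁≈F₂) (contiguous cycles₂ (≈-sym F₁≈F₂)) (ℕ.≤-total d₂ d₁) ,
  trans (sym (length-map _ C₁)) (trans (≈-length F₁≈F₂) (length-map _ C₂))
  where
  open Main k n
  d₁ d₂ : ℕ
  d₁ = proj₁ (translate-maximal (IsCycle⇒Cycle c₁))
  d₂ = proj₁ (translate-maximal (IsCycle⇒Cycle c₂))
  cycles₁ : Translates C₁ d₁
  cycles₁ = proj₁ (proj₂ (translate-maximal (IsCycle⇒Cycle c₁)))
  cycles₂ : Translates C₂ d₂
  cycles₂ = proj₁ (proj₂ (translate-maximal (IsCycle⇒Cycle c₂)))
  F₁≈F₂ : C₁ ⊕ + d₁ ≈ C₂ ⊕ + d₂
  F₁≈F₂ = maximal-unique (cycles₁ d₁ ℕ.≤-refl) (cycles₂ d₂ ℕ.≤-refl)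
    (proj₂ (proj₂ (translate-maximal (IsCycle⇒Cycle c₁))))
    (proj₂ (proj₂ (translate-maximal (IsCycle⇒Cycle c₂))))
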